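{- Let $G=(V=V_1\sqcup\dots\sqcup V_k,E)$ be a complete multipartite graph with $k$ parts. Then $G$ has an interconnection tree if and only if $|V|\ge 2(k-1)$.
   Context: Graphs are finite, simple and undirected. A multipartite graph $G=(V=V_1\sqcup\dots\sqcup V_k,E)$ is a graph whose vertex set is partitioned into $k$ non-empty parts $V_1,\dots,V_k$, each of which is an independent set; $\mathrm{Part}:V\to[k]=\{1,\dots,k\}$ is defined by $\mathrm{Part}(v)=i$ iff $v\in V_i$. It is complete multipartite if for all $i\ne j$, all $u\in V_i$ and $v\in V_j$, $(u,v)\in E$. For an edge, $\mathrm{Part}((u,v))=(\mathrm{Part}(u),\mathrm{Part}(v))$, and for a set $F$ of edges, $\mathrm{Part}(F)=\{\mathrm{Part}(e)\mid e\in F\}$. The quotient graph of $G$ is $G_{\mathrm{Part}}=([k],\mathrm{Part}(E))$. An interconnection tree of $G$ is a set $T\subseteq E$ such that (1) $T$ is a matching in $G$, and (2) $\mathrm{Part}(T)$ is a spanning tree of $G_{\mathrm{Part}}$, distinct edges of $T$ having distinct projections (so that $|T|=k-1$). -}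

module Defs where

open import Data.Fin.Base using (Fin)
open import Data.Fin.Properties using (any?; _≟_)
open import Data.List.Base using (List; []; _∷_; _∷ʳ_; length)
open import Data.List.Relation.Unary.Linked using (Linked)
open import Data.List.Relation.Unary.Unique.Propositional using (Unique)
open import Data.Nat.Base using (ℕ; _≤_)
open import Data.Product.Base using (_×_; _,_; ∃₂)
open import Data.Sum.Base using (_⊎_)
open import Data.Empty using (⊥)
open import Function.Definitions using (StrictlySurjective)
open import Level using (0ℓ)
open import Relation.Binary.Core using (Rel; _⇒_)
open import Relation.Binary.Construct.Closure.ReflexiveTransitive using (Star)
open import Relation.Binary.Definitions using (Symmetric; Irreflexive; Decidable)
open import Relation.Binary.PropositionalEquality using (_≡_; _≢_; sym; trans)
open import Relation.Nullary.Decidable.Core using (_×-dec_)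
open import Relation.Nullary.Negation.Core using (¬_)

-- Since the vertex set is fixed, a `Graph n` is the same thing as a (decidable)
-- set of edges on `Fin n`; an undirected edge {u , v} is present as both
-- Adj u v and Adj v u.
record Graph (n : ℕ) : Set₁ where
  field
    Adj        : Rel (Fin n) 0ℓ
    adj-sym    : Symmetric Adj
    adj-irrefl : Irreflexive _≡_ Adj
    adj?       : Decidable Adj

open Graph public

infix 4 _⊆ᴱ_

_⊆ᴱ_ : ∀ {n} → Graph n → Graph n → Set
F ⊆ᴱ G = Adj F ⇒ Adj G

SameEdge : ∀ {n} → Fin n × Fin n → Fin n × Fin n → Set
SameEdge (u , v) (u′ , v′) = (u ≡ u′ × v ≡ v′) ⊎ (u ≡ v′ × v ≡ u′)

-- By symmetry of Adj, this says that two edges sharing an endpoint are equal.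
IsMatching : ∀ {n} → Graph n → Set
IsMatching F = ∀ {u v w} → Adj F u v → Adj F u w → v ≡ w

Connected : ∀ {n} → Graph n → Set
Connected G = ∀ u v → Star (Adj G) u v

IsCycle : ∀ {n} → Graph n → List (Fin n) → Set
IsCycle G []       = ⊥
IsCycle G (v ∷ vs) =
  3 ≤ length (v ∷ vs) × Unique (v ∷ vs) × Linked (Adj G) ((v ∷ vs) ∷ʳ v)

Acyclic : ∀ {n} → Graph n → Set
Acyclic G = ∀ vs → ¬ IsCycle G vs

-- The graph without vertices counts as a tree.
IsTree : ∀ {n} → Graph n → Set
IsTree G = Connected G × Acyclic G

-- H is spanning because both graphs have vertex set `Fin n`.
IsSpanningTree : ∀ {n} → Graph n → Graph n → Set
IsSpanningTree H G = H ⊆ᴱ G × IsTree H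

record MultipartiteGraph (k n : ℕ) : Set₁ where
  field
    graph       : Graph n
    part        : Fin n → Fin k
    nonempty    : StrictlySurjective _≡_ part
    independent : ∀ {u v} → part u ≡ part v → ¬ Adj graph u v

module _ {k n : ℕ} (G : MultipartiteGraph k n) where
  open MultipartiteGraph G

  IsComplete : Set
  IsComplete = ∀ u v → part u ≢ part v → Adj graph u v

  -- Part(F), for a set F of edges of G.
  project : (F : Graph n) → F ⊆ᴱ graph → Graph k
  project F F⊆G = record
    { Adj        = λ i j → ∃₂ λ u v → Adj F u v × part u ≡ i × part v ≡ j
    ; adj-sym    = λ (u , v , uv , pu , pv) → v , u , adj-sym F uv , pv , pu
    ; adj-irrefl = λ i≡j (u , v , uv , pu , pv) →
        independent (trans pu (trans i≡j (sym pv))) (F⊆G uv)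
    ; adj?       = λ i j → any? λ u → any? λ v →
        adj? F u v ×-dec part u ≟ i ×-dec part v ≟ j
    }

  quotient : Graph k
  quotient = project graph (λ uv → uv)

  record InterconnectionTree : Set₁ where
    field
      T            : Graph n
      T⊆E          : T ⊆ᴱ graph
      matching     : IsMatching T
      spanningTree : IsSpanningTree (project T T⊆E) quotient
      distinct     : ∀ {u v u′ v′} → Adj T u v → Adj T u′ v′ →
                     SameEdge (part u , part v) (part u′ , part v′) →
                     SameEdge (u , v) (u′ , v′)

{-# OPTIONS --safe #-}
-- Necessity: root the projected tree at a part r by distance.  Every part other
-- than r has an edge of T to a strictly closer part, and the 2 (k - 1) endpoints
-- of these edges are distinct because T is a matching.
--
-- Sufficiency: grow a tree from r, joining in each step a fresh vertex of an
-- unplaced part to an unused vertex of a placed part.  Parts with at least two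
-- vertices are placed first; each of them brings a new unused vertex.  Once only
-- singletons remain, running out of unused vertices after m < k - 1 steps would
-- give n ≤ 2 m + (k - 1 - m) < 2 (k - 1).
module Submission where

open import Defs
open import Data.Nat.Base using (ℕ; _*_; _∸_; _≥_)
open import Function.Bundles using (_⇔_)

open import Data.Fin.Base using (Fin; zero; suc)
open import Data.Fin.Properties
  using (any?; _≟_; injective⇒≤; +↔⊎; suc-injective)
open import Data.List.Base
  using (List; []; _∷_; _++_; _∷ʳ_; length; lookup; map; filter; allFin)
open import Data.List.Membership.Propositional using (_∈_; _∉_)
open import Data.List.Membership.Propositional.Properties
  using (∈-lookup; ∈-allFin; ∈-filter⁺; ∈-filter⁻; ∈-map⁺; ∈-++⁺ˡ; ∈-++⁺ʳ)
import Data.List.Membership.Setoid.Properties as Membershipₛ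
open import Data.List.Properties using (length-++; length-map)
open import Data.List.Relation.Unary.All as All using ([]; _∷_)
open import Data.List.Relation.Unary.All.Properties using (¬Any⇒All¬; All¬⇒¬Any)
open import Data.List.Relation.Unary.Any as Any using (here; there; index)
open import Data.List.Relation.Unary.Linked using (Linked; _∷_)
open import Data.List.Relation.Unary.Unique.Propositional using (Unique; []; _∷_)
import Data.List.Relation.Unary.Unique.Propositional.Properties as Unique
open import Data.Nat.Base using (zero; suc; _+_; _≤_; _<_; z≤n; s≤s; s≤s⁻¹)
open import Data.Nat.Properties
  using (≤-refl; ≤-trans; ≤-reflexive; <⇒≱; <⇒≤; <-asym; +-identityʳ;
         +-monoˡ-<; +-monoʳ-≤; module ≤-Reasoning)
open import Data.Nat.Solver using (module +-*-Solver)
open import Data.Product.Base using (_×_; _,_; ∃; ∃₂; ∃-syntax; proj₁; proj₂; swap)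
import Data.Product.Properties as Product
open import Data.Sum.Base as Sum using (_⊎_; inj₁; inj₂)
open import Function.Base using (_∘_)
open import Function.Bundles using (mk⇔; Injection; Inverse)
open import Function.Properties.Inverse using (↔⇒↣)
open import Function.Definitions using (Injective)
open import Relation.Binary.Construct.Closure.ReflexiveTransitive
  using (Star; ε; _◅_; _◅◅_; reverse)
import Relation.Binary.Construct.Closure.ReflexiveTransitive as Star
open import Relation.Binary.PropositionalEquality
  using (_≡_; _≢_; refl; sym; trans; cong; cong₂; subst; subst₂; setoid)
open import Relation.Nullary using (¬_; Dec; yes; no; contradiction)
open import Relation.Nullary.Decidable using (_×-dec_; _⊎-dec_; ¬?)
open import Relation.Unary using (Pred; Decidable)
open import Level using (0ℓ)

private
  variable
    k n : ℕ

-- Counting with lists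

∈-subst : ∀ {A : Set} {xs : List A} {x y} → x ≡ y → x ∈ xs → y ∈ xs
∈-subst refl x∈ = x∈

_∈?_ : ∀ (i : Fin n) xs → Dec (i ∈ xs)
i ∈? xs = Any.any? (i ≟_) xs

lookup-injective : ∀ {A : Set} {xs : List A} → Unique xs →
                   Injective _≡_ _≡_ (lookup xs)
lookup-injective {xs = _ ∷ _} _ {zero} {zero} _ = refl
lookup-injective {xs = _ ∷ _} (x∉ ∷ _) {zero} {suc j} eq =
  contradiction eq (All.lookup x∉ (∈-lookup j))
lookup-injective {xs = _ ∷ _} (x∉ ∷ _) {suc i} {zero} eq =
  contradiction (sym eq) (All.lookup x∉ (∈-lookup i))
lookup-injective {xs = _ ∷ _} (_ ∷ u) {suc i} {suc j} eq =
  cong suc (lookup-injective u eq)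

unique⇒length≤ : ∀ {xs : List (Fin n)} → Unique xs → length xs ≤ n
unique⇒length≤ u = injective⇒≤ (lookup-injective u)

-- Sending each element to a position where it occurs is injective, because the position determines
-- the element.
covering⇒≤length : ∀ {xs : List (Fin n)} → (∀ i → i ∈ xs) → n ≤ length xs
covering⇒≤length {n} cover = injective⇒≤ {f = index ∘ cover} λ {i} {j} →
  Membershipₛ.index-injective (setoid (Fin n)) (cover i) (cover j)

-- An absent element could be prepended, giving a duplicate-free list longer than `n`.
unique-full : ∀ {xs : List (Fin n)} → Unique xs → n ≤ length xs → ∀ i → i ∈ xs
unique-full {xs = xs} u n≤ i with i ∈? xs
... | yes i∈ = i∈
... | no  i∉ = contradiction n≤ (<⇒≱ (unique⇒length≤ (¬Any⇒All¬ xs i∉ ∷ u)))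

missing : ∀ {xs : List (Fin n)} → length xs < n → ∃[ i ] i ∉ xs
missing {xs = xs} l< with any? (λ i → ¬? (i ∈? xs))
... | yes found = found
... | no  none  = contradiction (covering⇒≤length cover) (<⇒≱ l<)
  where
  cover : ∀ i → i ∈ xs
  cover i with i ∈? xs
  ... | yes i∈ = i∈
  ... | no  i∉ = contradiction (i , i∉) none

complement : List (Fin n) → List (Fin n)
complement xs = filter (λ i → ¬? (i ∈? xs)) (allFin _)

∈-complement : ∀ {xs : List (Fin n)} {i} → i ∉ xs → i ∈ complement xs
∈-complement {xs = xs} i∉ = ∈-filter⁺ (λ i → ¬? (i ∈? xs)) (∈-allFin _) i∉

length-complement : ∀ {xs : List (Fin n)} → Unique xs →
                    length xs + length (complement xs) ≤ n
length-complement {xs = xs} u =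
  ≤-trans (≤-reflexive (sym (length-++ xs))) (unique⇒length≤
    (Unique.++⁺ u (Unique.filter⁺ P? (Unique.allFin⁺ _))
      λ (i∈ , i∈ᶜ) → proj₂ (∈-filter⁻ P? {xs = allFin _} i∈ᶜ) i∈))
  where P? = λ i → ¬? (i ∈? xs)

-- Necessity

least : ∀ {P : Pred ℕ 0ℓ} → Decidable P → ∀ m → P m →
        ∃[ d ] P d × (∀ {e} → P e → d ≤ e)
least P? zero    p = zero , p , λ _ → z≤n
least {P} P? (suc m) p with P? zero
... | yes p₀ = zero , p₀ , λ _ → z≤n
... | no ¬p₀ with least (P? ∘ suc) m p
...   | d , pd , min = suc d , pd , below _
  where
  below : ∀ e → P e → suc d ≤ e
  below zero    p₀ = contradiction p₀ ¬p₀
  below (suc e) pe = s≤s (min pe)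

-- Distance from a root

module _ (H : Graph n) (r : Fin n) where

  -- With the length as an index, having a walk of that length is decidable, so `least` can select a
  -- shortest one.
  Walk : ℕ → Fin n → Set
  Walk zero    i = i ≡ r
  Walk (suc m) i = ∃[ j ] Adj H i j × Walk m j

  walk? : ∀ i m → Dec (Walk m i)
  walk? i zero    = i ≟ r
  walk? i (suc m) = any? λ j → adj? H i j ×-dec walk? j m

  star⇒walk : ∀ {i} → Star (Adj H) i r → ∃[ m ] Walk m i
  star⇒walk ε        = zero , refl
  star⇒walk (e ◅ es) with star⇒walk es
  ... | m , w = suc m , _ , e , w

  -- `d` is the length of a shortest walk to `r`, and the first step of such a walk decreases it.
  distance : Connected H → ∃[ d ] ∀ i → i ≢ r → ∃[ j ] Adj H i j × d j < d i
  distance conn = d , closer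
    where
    shortest : ∀ i → ∃[ m ] Walk m i × (∀ {e} → Walk e i → m ≤ e)
    shortest i with star⇒walk (conn i r)
    ... | m , w = least (walk? i) m w

    d : Fin n → ℕ
    d i = proj₁ (shortest i)

    closer : ∀ i → i ≢ r → ∃[ j ] Adj H i j × d j < d i
    closer i i≢r with shortest i
    ... | zero  , i≡r           , _ = contradiction i≡r i≢r
    -- The tail `w` is a walk of length `m` from `j`, so `d j` is at most `m`.
    ... | suc m , (j , ij , w) , _ = j , ij , s≤s (proj₂ (proj₂ (shortest j)) w)

-- Counting the endpoints of descending edges

module _ (G : MultipartiteGraph (suc k) n) (I : InterconnectionTree G) where
  open MultipartiteGraph G
  open InterconnectionTree I

  tree⇒size : 2 * k ≤ n
  tree⇒size = subst (_≤ n) (cong (k +_) (sym (+-identityʳ k)))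
    (injective⇒≤ {f = endpoint ∘ Inverse.to +↔⊎}
      (Injection.injective (↔⇒↣ +↔⊎) ∘ endpoint-injective))
    where
    rooted = distance (project G T T⊆E) zero (proj₁ (proj₂ spanningTree))
    d = proj₁ rooted

    step : ∀ (i : Fin k) → ∃₂ λ u v →
           Adj T u v × part u ≡ suc i × d (part v) < d (part u)
    -- Part `zero` is the root, so the `k` remaining parts are exactly the `suc i`.
    step i with proj₂ rooted (suc i) (λ ())
    ... | j , (u , v , uv , pu , pv) , lt =
      u , v , uv , pu , subst₂ (λ a b → d a < d b) (sym pv) (sym pu) lt

    child parent : Fin k → Fin n
    child  = proj₁ ∘ step
    parent = proj₁ ∘ proj₂ ∘ step

    edge : ∀ i → Adj T (child i) (parent i)
    edge = proj₁ ∘ proj₂ ∘ proj₂ ∘ step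

    part-child : ∀ i → part (child i) ≡ suc i
    part-child = proj₁ ∘ proj₂ ∘ proj₂ ∘ proj₂ ∘ step

    descent : ∀ i → d (part (parent i)) < d (part (child i))
    descent = proj₂ ∘ proj₂ ∘ proj₂ ∘ proj₂ ∘ step

    child-injective : Injective _≡_ _≡_ child
    child-injective {i} {j} eq = suc-injective
      (trans (sym (part-child i)) (trans (cong part eq) (part-child j)))

    -- If the two vertices agreed, the matching would make both edges the same edge with its ends
    -- exchanged, and the distance would decrease in both directions.
    child≢parent : ∀ i j → child i ≢ parent j
    child≢parent i j ci≡pj = <-asym (descent i)
      (subst₂ (λ a b → d (part a) < d (part b)) (sym ci≡pj) cj≡pi (descent j))
      where
      cj≡pi : child j ≡ parent i
      cj≡pi = matching (adj-sym T (edge j))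
                       (subst (λ w → Adj T w (parent i)) ci≡pj (edge i))

    endpoint : Fin k ⊎ Fin k → Fin n
    endpoint = Sum.[ child , parent ]

    endpoint-injective : Injective _≡_ _≡_ endpoint
    endpoint-injective {inj₁ i} {inj₁ j} eq = cong inj₁ (child-injective eq)
    endpoint-injective {inj₁ i} {inj₂ j} eq = contradiction eq (child≢parent i j)
    endpoint-injective {inj₂ i} {inj₁ j} eq = contradiction (sym eq) (child≢parent j i)
    -- The matching property at the common parent identifies the two children.
    endpoint-injective {inj₂ i} {inj₂ j} eq = cong inj₂ (child-injective
      (matching (adj-sym T (edge i))
                (subst (λ w → Adj T w (child j)) (sym eq) (adj-sym T (edge j)))))

-- Cycles

-- When this holds for every `x` in `S`, the graph induced on `S` has minimum degree at least two.
TwoNeighbours : ∀ {A : Set} → (A → A → Set) → List A → A → Set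
TwoNeighbours R S x = ∃₂ λ y z → y ∈ S × z ∈ S × y ≢ z × R x y × R x z

module _ {A : Set} {R : A → A → Set} (R-sym : ∀ {x y} → R x y → R y x) where

  linked-last : ∀ {x q} xs → Linked R (x ∷ xs ∷ʳ q) →
                ∃[ y ] y ∈ x ∷ xs × R y q
  linked-last []       (e ∷ _) = _ , here refl , e
  linked-last (_ ∷ xs) (_ ∷ l) with linked-last xs l
  ... | y , y∈ , e = y , there y∈ , e

  -- On a path from `a` to `q`, an inner vertex has its predecessor and its successor as neighbours.
  -- They differ by uniqueness, or by `q ∉ a ∷ xs` when the successor is the end `q`.
  interior : ∀ {S a q} xs → (∀ {y} → y ∈ a ∷ xs → y ∈ S) → q ∈ S →
             q ∉ a ∷ xs → Unique (a ∷ xs) → Linked R (a ∷ xs ∷ʳ q) →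
             ∀ {x} → x ∈ xs → TwoNeighbours R S x
  interior (b ∷ []) ⊆S q∈ q∉ _ (ab ∷ bq ∷ _) (here refl) =
    _ , _ , ⊆S (here refl) , q∈ , (λ a≡q → q∉ (here (sym a≡q))) , R-sym ab , bq
  interior (b ∷ c ∷ cs) ⊆S _ _ ((_ ∷ a≢c ∷ _) ∷ _) (ab ∷ bc ∷ _) (here refl) =
    _ , _ , ⊆S (here refl) , ⊆S (there (there (here refl))) , a≢c , R-sym ab , bc
  interior (b ∷ cs) ⊆S q∈ q∉ (_ ∷ u) (_ ∷ l) (there x∈) =
    interior cs (⊆S ∘ there) q∈ (q∉ ∘ there) u l x∈

-- The first vertex is adjacent to the second and to the last, which differ since the length is at
-- least three. The second lies between the first and the third. All later ones are interior to the
-- path from the second vertex back to the first.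
cycle⇒twoNeighbours : ∀ (H : Graph n) vs → IsCycle H vs →
                      ∀ {x} → x ∈ vs → TwoNeighbours (Adj H) vs x
cycle⇒twoNeighbours H (v ∷ []) (s≤s () , _)
cycle⇒twoNeighbours H (v ∷ w ∷ []) (s≤s (s≤s ()) , _)
cycle⇒twoNeighbours H (v ∷ w ∷ c ∷ cs) (_ , (v∉ ∷ w∉ ∷ _) , (vw ∷ _ ∷ l)) (here refl)
  with linked-last (adj-sym H) cs l
... | y , y∈ , yv = w , y , there (here refl) , there (there y∈) ,
                    All.lookup w∉ y∈ , vw , adj-sym H yv
cycle⇒twoNeighbours H (v ∷ w ∷ c ∷ cs) (_ , ((_ ∷ v≢c ∷ _) ∷ _) , (vw ∷ wc ∷ _)) (there (here refl)) =
  v , c , here refl , there (there (here refl)) , v≢c , adj-sym H vw , wc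
cycle⇒twoNeighbours H (v ∷ w ∷ c ∷ cs) (_ , (v∉ ∷ u) , (_ ∷ l)) (there (there x∈)) =
  interior (adj-sym H) (c ∷ cs) there (here refl) (All¬⇒¬Any v∉) u l x∈

-- Sufficiency

endpoints : ∀ {A : Set} → List (A × A) → List A
endpoints []            = []
endpoints ((u , v) ∷ E) = u ∷ v ∷ endpoints E

length-endpoints : ∀ {A : Set} (E : List (A × A)) → length (endpoints E) ≡ 2 * length E
length-endpoints []      = refl
length-endpoints (_ ∷ E) = trans (cong (2 +_) (length-endpoints E))
  (solve 1 (λ m → con 2 :+ con 2 :* m := con 2 :* (con 1 :+ m)) refl (length E))
  where open +-*-Solver

-- The order within a pair records which end was attached as a leaf; the symmetric closure forgets
-- it.
Joins : ∀ {A : Set} → List (A × A) → A → A → Set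
Joins E u v = (u , v) ∈ E ⊎ (v , u) ∈ E

joins-endpoint : ∀ {A : Set} {E : List (A × A)} {u v} → Joins E u v → u ∈ endpoints E
joins-endpoint (inj₁ (here refl)) = here refl
joins-endpoint (inj₁ (there e))   = there (there (joins-endpoint (inj₁ e)))
joins-endpoint (inj₂ (here refl)) = there (here refl)
joins-endpoint (inj₂ (there e))   = there (there (joins-endpoint (inj₂ e)))

joins-∷ : ∀ {A : Set} {E : List (A × A)} {e u v} → Joins E u v → Joins (e ∷ E) u v
joins-∷ = Sum.map there there

joins-uncons : ∀ {A : Set} {E : List (A × A)} {e u v} → Joins (e ∷ E) u v →
               (u , v) ≡ e ⊎ (v , u) ≡ e ⊎ Joins E u v
joins-uncons (inj₁ (here eq)) = inj₁ eq
joins-uncons (inj₁ (there e)) = inj₂ (inj₂ (inj₁ e))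
joins-uncons (inj₂ (here eq)) = inj₂ (inj₁ eq)
joins-uncons (inj₂ (there e)) = inj₂ (inj₂ (inj₂ e))

-- Trees grown leaf by leaf

module _ (G : MultipartiteGraph (suc k) n) (complete : IsComplete G) where
  open MultipartiteGraph G

  -- Part zero is the root, and an edge (u , v) is listed from its new leaf u.
  places : List (Fin n × Fin n) → List (Fin (suc k))
  places []            = zero ∷ []
  places ((u , _) ∷ E) = part u ∷ places E

  length-places : ∀ E → length (places E) ≡ suc (length E)
  length-places []      = refl
  length-places (_ ∷ E) = cong suc (length-places E)

  Free : List (Fin n × Fin n) → Fin n → Set
  Free E v = part v ∈ places E × v ∉ endpoints E

  -- A derivation is an order of attaching leaves, and each required property of the tree is proved
  -- by induction on it.
  data Grown : List (Fin n × Fin n) → Set where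
    seed   : Grown []
    attach : ∀ {E u v} → Grown E → part u ∉ places E → Free E v →
             Grown ((u , v) ∷ E)

  places-unique : ∀ {E} → Grown E → Unique (places E)
  places-unique seed              = [] ∷ []
  places-unique (attach g new _) = ¬Any⇒All¬ _ new ∷ places-unique g

  endpoints-placed : ∀ {E} → Grown E → ∀ {x} → x ∈ endpoints E → part x ∈ places E
  endpoints-placed (attach g _ _)         (here refl)         = here refl
  endpoints-placed (attach g _ (pv∈ , _)) (there (here refl)) = there pv∈
  endpoints-placed (attach g _ _)         (there (there x∈))  =
    there (endpoints-placed g x∈)

  edge-parts : ∀ {E} → Grown E → ∀ {u v} → (u , v) ∈ E → part u ≢ part v
  edge-parts (attach g new (pv∈ , _)) (here refl) eq = new (∈-subst (sym eq) pv∈)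
  edge-parts (attach g _ _)           (there e)      = edge-parts g e

  joins-parts : ∀ {E} → Grown E → ∀ {u v} → Joins E u v → part u ≢ part v
  joins-parts g (inj₁ e) = edge-parts g e
  joins-parts g (inj₂ e) = edge-parts g e ∘ sym

  joins-matching : ∀ {E} → Grown E → ∀ {u v w} → Joins E u v → Joins E u w → v ≡ w
  joins-matching seed (inj₁ ())
  joins-matching seed (inj₂ ())
  joins-matching (attach {E} {x} {y} g new (py∈ , y∉)) e f
    with joins-uncons e | joins-uncons f
  ... | inj₁ refl        | inj₁ refl        = refl
  -- Reading the newest edge in both directions from `u` would make it a loop, so all the vertices
  -- coincide.
  ... | inj₁ refl        | inj₂ (inj₁ refl) = refl
  ... | inj₁ refl        | inj₂ (inj₂ f′)   =
    contradiction (endpoints-placed g (joins-endpoint f′)) new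
  ... | inj₂ (inj₁ refl) | inj₁ refl        = refl
  ... | inj₂ (inj₁ refl) | inj₂ (inj₁ refl) = refl
  ... | inj₂ (inj₁ refl) | inj₂ (inj₂ f′)   = contradiction (joins-endpoint f′) y∉
  ... | inj₂ (inj₂ e′)   | inj₁ refl        =
    contradiction (endpoints-placed g (joins-endpoint e′)) new
  ... | inj₂ (inj₂ e′)   | inj₂ (inj₁ refl) = contradiction (joins-endpoint e′) y∉
  ... | inj₂ (inj₂ e′)   | inj₂ (inj₂ f′)   = joins-matching g e′ f′

  -- This is the adjacency that `project` computes from `Joins E`, available before the tree is
  -- packaged as a `Graph`.
  PartJoins : List (Fin n × Fin n) → Fin (suc k) → Fin (suc k) → Set
  PartJoins E i j = ∃₂ λ u v → Joins E u v × part u ≡ i × part v ≡ j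

  partJoins-sym : ∀ {E i j} → PartJoins E i j → PartJoins E j i
  partJoins-sym (u , v , uv , pu , pv) = v , u , Sum.swap uv , pv , pu

  partJoins-∷ : ∀ {E e i j} → PartJoins E i j → PartJoins (e ∷ E) i j
  partJoins-∷ (u , v , uv , pu , pv) = u , v , joins-∷ uv , pu , pv

  partJoins-uncons : ∀ {E u v i j} → PartJoins ((u , v) ∷ E) i j →
    (i ≡ part u × j ≡ part v) ⊎ (i ≡ part v × j ≡ part u) ⊎ PartJoins E i j
  partJoins-uncons (a , b , ab , refl , refl) with joins-uncons ab
  ... | inj₁ refl        = inj₁ (refl , refl)
  ... | inj₂ (inj₁ refl) = inj₂ (inj₁ (refl , refl))
  ... | inj₂ (inj₂ ab′)  = inj₂ (inj₂ (a , b , ab′ , refl , refl))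

  partJoins-placed : ∀ {E i j} → Grown E → PartJoins E i j → i ∈ places E
  partJoins-placed g (_ , _ , uv , refl , _) = endpoints-placed g (joins-endpoint uv)

  connected-root : ∀ {E} → Grown E → ∀ {i} → i ∈ places E → Star (PartJoins E) i zero
  connected-root seed (here refl) = ε
  connected-root (attach {u = u} {v} g _ (pv∈ , _)) (here refl) =
    (u , v , inj₁ (here refl) , refl , refl) ◅ Star.map partJoins-∷ (connected-root g pv∈)
  connected-root (attach g _ _) (there i∈) = Star.map partJoins-∷ (connected-root g i∈)

  -- The part attached last is a leaf, so it cannot belong to the set S.
  no-2-core : ∀ {E} → Grown E → ∀ S →
              (∀ {i} → i ∈ S → TwoNeighbours (PartJoins E) S i) → ∀ {i} → i ∉ S
  no-2-core seed S core i∈ with core i∈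
  ... | _ , _ , _ , _ , _ , (_ , _ , inj₁ () , _) , _
  ... | _ , _ , _ , _ , _ , (_ , _ , inj₂ () , _) , _
  no-2-core (attach {E} {u} {v} g new (pv∈ , _)) S core = no-2-core g S core′
    where
    neighbour-leaf : ∀ {j} → PartJoins ((u , v) ∷ E) (part u) j → j ≡ part v
    neighbour-leaf e with partJoins-uncons e
    ... | inj₁ (_ , eq)          = eq
    ... | inj₂ (inj₁ (eq , _))   = contradiction (∈-subst (sym eq) pv∈) new
    ... | inj₂ (inj₂ e′)         = contradiction (partJoins-placed g e′) new

    u∉S : part u ∉ S
    u∉S u∈ with core u∈
    ... | _ , _ , _ , _ , y≢z , uy , uz =
      y≢z (trans (neighbour-leaf uy) (sym (neighbour-leaf uz)))

    -- Adjacencies within `S` avoid the newest leaf, so they were present before it was attached and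
    -- the induction hypothesis applies to the same `S`.
    shrink : ∀ {i j} → i ∈ S → j ∈ S → PartJoins ((u , v) ∷ E) i j → PartJoins E i j
    shrink i∈ j∈ e with partJoins-uncons e
    ... | inj₁ (refl , _)        = contradiction i∈ u∉S
    ... | inj₂ (inj₁ (_ , refl)) = contradiction j∈ u∉S
    ... | inj₂ (inj₂ e′)         = e′

    core′ : ∀ {i} → i ∈ S → TwoNeighbours (PartJoins E) S i
    core′ i∈ with core i∈
    ... | y , z , y∈ , z∈ , y≢z , iy , iz =
      y , z , y∈ , z∈ , y≢z , shrink i∈ y∈ iy , shrink i∈ z∈ iz

  -- Each part is attached at most once: a new leaf lies in an unplaced part, while all earlier
  -- leaves lie in placed ones.
  child-determined : ∀ {E} → Grown E → ∀ {u v u′ v′} → (u , v) ∈ E → (u′ , v′) ∈ E →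
                     part u ≡ part u′ → (u , v) ≡ (u′ , v′)
  child-determined g (here refl) (here refl) _ = refl
  child-determined (attach g new _) (here refl) (there f) eq =
    contradiction (∈-subst (sym eq) (endpoints-placed g (joins-endpoint (inj₁ f)))) new
  child-determined (attach g new _) (there e) (here refl) eq =
    contradiction (∈-subst eq (endpoints-placed g (joins-endpoint (inj₁ e)))) new
  child-determined (attach g _ _) (there e) (there f) eq = child-determined g e f eq

  -- The newer of two edges has its leaf in a part that no older edge meets; a single edge cannot
  -- reverse onto itself because its ends lie in different parts.
  no-reversed : ∀ {E} → Grown E → ∀ {u v u′ v′} → (u , v) ∈ E → (u′ , v′) ∈ E →
                part u ≡ part v′ → part v ≢ part u′
  no-reversed g@(attach _ _ _) (here refl) (here refl) eq _ = edge-parts g (here refl) eq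
  no-reversed (attach g new _) (here refl) (there f) eq _ =
    contradiction (∈-subst (sym eq) (endpoints-placed g (joins-endpoint (inj₂ f)))) new
  no-reversed (attach g new _) (there e) (here refl) _ eq =
    contradiction (∈-subst eq (endpoints-placed g (joins-endpoint (inj₂ e)))) new
  no-reversed (attach g _ _) (there e) (there f) eq = no-reversed g e f eq

  joins-distinct : ∀ {E} → Grown E → ∀ {u v u′ v′} → Joins E u v → Joins E u′ v′ →
                   part u ≡ part u′ → part v ≡ part v′ → u ≡ u′ × v ≡ v′
  joins-distinct g (inj₁ e) (inj₁ f) pu _  = Product.,-injective (child-determined g e f pu)
  joins-distinct g (inj₁ e) (inj₂ f) pu pv = contradiction pv (no-reversed g e f pu)
  joins-distinct g (inj₂ e) (inj₁ f) pu pv = contradiction pu (no-reversed g e f pv)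
  joins-distinct g (inj₂ e) (inj₂ f) _  pv =
    swap (Product.,-injective (child-determined g e f pv))

  -- Assembling the interconnection tree

  grown⇒tree : ∀ {E} → Grown E → (∀ i → i ∈ places E) → InterconnectionTree G
  grown⇒tree {E} g placed = record
    { T            = T
    ; T⊆E          = T⊆E
    ; matching     = joins-matching g
    ; spanningTree =
        (λ (u , v , uv , pu , pv) → u , v , T⊆E uv , pu , pv)
      , (λ i j → to-root i ◅◅ reverse partJoins-sym (to-root j))
      , acyclic
    ; distinct     = λ where
        uv uv′ (inj₁ (pu , pv)) → inj₁ (joins-distinct g uv uv′ pu pv)
        uv uv′ (inj₂ (pu , pv)) → inj₂ (joins-distinct g uv (Sum.swap uv′) pu pv)
    }
    where
    _∈E?_ : ∀ u v → Dec ((u , v) ∈ E)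
    u ∈E? v = Any.any? (Product.≡-dec _≟_ _≟_ (u , v)) E

    T : Graph n
    T = record
      { Adj        = Joins E
      ; adj-sym    = Sum.swap
      ; adj-irrefl = λ u≡v uv → joins-parts g uv (cong part u≡v)
      ; adj?       = λ u v → (u ∈E? v) ⊎-dec (v ∈E? u)
      }

    T⊆E : T ⊆ᴱ graph
    -- Completeness enters here: any pair of vertices in different parts is an edge of `G`.
    T⊆E uv = complete _ _ (joins-parts g uv)

    to-root : ∀ i → Star (PartJoins E) i zero
    to-root i = connected-root g (placed i)

    acyclic : Acyclic (project G T T⊆E)
    acyclic []       ()
    -- A cycle would be a nonempty set whose members all have two neighbours inside it.
    acyclic (v ∷ vs) cyc = no-2-core g (v ∷ vs)
      (cycle⇒twoNeighbours (project G T T⊆E) (v ∷ vs) cyc) (here refl)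

  -- Choosing the next attachment

  Viable : List (Fin n × Fin n) → Set
  Viable E = ∃ (Free E) ⊎ (∀ {u w} → part u ∉ places E → part u ≡ part w → u ≡ w)

  free? : ∀ E → Decidable (Free E)
  free? E v = (part v ∈? places E) ×-dec ¬? (v ∈? endpoints E)

  rep : Fin (suc k) → Fin n
  rep i = proj₁ (nonempty i)

  part-rep : ∀ i → part (rep i) ≡ i
  part-rep i = proj₂ (nonempty i)

  -- Every vertex of a placed part is one of the `2 * m` endpoints, and each unplaced part
  -- contributes only its representative.
  saturated-size : ∀ {E} → Grown E → ¬ ∃ (Free E) →
    (∀ {u w} → part u ∉ places E → part u ≡ part w → u ≡ w) → n ≤ length E + k
  saturated-size {E} g none single = begin
    n                                                  ≤⟨ covering⇒≤length cover ⟩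
    length (endpoints E ++ map rep C)                  ≡⟨ length-++ (endpoints E) ⟩
    length (endpoints E) + length (map rep C)          ≡⟨ cong₂ _+_ (length-endpoints E) (length-map rep C) ⟩
    2 * m + c                                          ≡⟨ solve 2 (λ m c → con 2 :* m :+ c := m :+ (m :+ c)) refl m c ⟩
    m + (m + c)                                        ≤⟨ +-monoʳ-≤ m (s≤s⁻¹ m+c<k) ⟩
    m + k                                              ∎
    where
    open ≤-Reasoning
    open +-*-Solver
    C = complement (places E)
    m = length E
    c = length C

    -- The root makes `m + 1` placed parts out of `m` edges.
    m+c<k : suc m + c ≤ suc k
    m+c<k = subst (λ l → l + c ≤ suc k) (length-places E)
                  (length-complement (places-unique g))

    cover : ∀ v → v ∈ endpoints E ++ map rep C
    cover v with part v ∈? places E | v ∈? endpoints E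
    ... | _       | yes v∈ = ∈-++⁺ˡ v∈
    ... | yes pv∈ | no  v∉ = contradiction (v , pv∈ , v∉) none
    ... | no  pv∉ | no  _  = ∈-++⁺ʳ (endpoints E)
      (subst (_∈ map rep C) (sym (single pv∉ (sym (part-rep (part v)))))
             (∈-map⁺ rep (∈-complement pv∉)))

  -- An unplaced part with two vertices is preferred, and `Viable` supplies the free vertex to
  -- attach it to. If there is none, all unplaced parts are singletons from then on, and the size
  -- bound supplies the free vertex.
  extend : ∀ {E} → 2 * k ≤ n → length E < k → Grown E → Viable E →
           ∃[ e ] Grown (e ∷ E) × Viable (e ∷ E)
  extend {E} size m<k g viable
    with any? (λ u → any? λ w → ¬? (part u ∈? places E) ×-dec part u ≟ part w ×-dec ¬? (u ≟ w))
       | any? (free? E)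
  ... | yes (u , w , new , pu≡pw , u≢w) | yes (v , pv∈ , v∉) =
    -- The second vertex `w` of the new part becomes free: it is neither `u` nor in a previously
    -- placed part, where `v` and all older endpoints lie.
    (u , v) , attach g new (pv∈ , v∉) , inj₁ (w , here (sym pu≡pw) , λ where
      (here w≡u)          → u≢w (sym w≡u)
      (there (here refl)) → new (∈-subst (sym pu≡pw) pv∈)
      (there (there w∈))  → new (∈-subst (sym pu≡pw) (endpoints-placed g w∈)))
  ... | yes (u , w , new , pu≡pw , u≢w) | no none =
    contradiction viable Sum.[ none , (λ single → u≢w (single new pu≡pw)) ]
  ... | no multiple | free-vertex = attach-singleton free-vertex
    where
    single : ∀ {u w} → part u ∉ places E → part u ≡ part w → u ≡ w
    single {u} {w} new eq with u ≟ w
    ... | yes u≡w = u≡w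
    ... | no  u≢w = contradiction (u , w , new , eq , u≢w) multiple

    attach-singleton : Dec (∃ (Free E)) → ∃[ e ] Grown (e ∷ E) × Viable (e ∷ E)
    attach-singleton (yes (v , v-free))
      -- Only `length E + 1` of the `k + 1` parts are placed, so one remains.
      with missing {xs = places E} (subst (_< suc k) (sym (length-places E)) (s≤s m<k))
    ... | i , i∉ = (rep i , v)
      , attach g (subst (_∉ places E) (sym (part-rep i)) i∉) v-free
      , inj₂ (λ new → single (new ∘ there))
    attach-singleton (no none) = contradiction size (<⇒≱ (begin-strict
      n                 ≤⟨ saturated-size g none single ⟩
      length E + k      <⟨ +-monoˡ-< k m<k ⟩
      k + k             ≡⟨ cong (k +_) (sym (+-identityʳ k)) ⟩
      2 * k             ∎))
      where open ≤-Reasoning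

  grow : 2 * k ≤ n → ∀ m → m ≤ k → ∃[ E ] length E ≡ m × Grown E × Viable E
  grow size zero    _   =
    -- Before any edge exists, a vertex of the root part is free.
    [] , refl , seed , inj₁ (rep zero , here (part-rep zero) , λ ())
  grow size (suc m) m<k with grow size m (<⇒≤ m<k)
  ... | E , refl , g , viable with extend size m<k g viable
  ...   | e , g′ , viable′ = e ∷ E , refl , g′ , viable′

  size⇒tree : 2 * k ≤ n → InterconnectionTree G
  size⇒tree size with grow size k ≤-refl
  -- After `k` attachments the duplicate-free list of places has length `k + 1`, hence contains
  -- every part.
  ... | E , eq , g , _ = grown⇒tree g (unique-full (places-unique g)
    (≤-reflexive (sym (trans (length-places E) (cong suc eq)))))

-- A vertex would have a part in `Fin 0`, so there are no vertices and every condition is vacuous.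
partless-tree : (G : MultipartiteGraph 0 n) → InterconnectionTree G
partless-tree G = record
  { T            = graph
  ; T⊆E          = λ uv → uv
  ; matching     = λ {u} → no-vertex u
  ; spanningTree = (λ uv → uv) , (λ ()) , λ where
      []      ()
      (() ∷ _)
  ; distinct     = λ {u} → no-vertex u
  }
  where
  open MultipartiteGraph G
  no-vertex : ∀ {A : Set} → Fin _ → A
  no-vertex u with () ← part u

lemma9 : ∀ {k n : ℕ} (G : MultipartiteGraph k n) → IsComplete G →
    InterconnectionTree G ⇔ (n ≥ 2 * (k ∸ 1))
-- Truncated subtraction turns the bound into `n ≥ 0`.
lemma9 {zero}  G _        = mk⇔ (λ _ → z≤n) (λ _ → partless-tree G)
lemma9 {suc k} G complete = mk⇔ (tree⇒size G) (size⇒tree G complete)
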